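{- Let $E(m,n)$ denote the expected number of rounds in Urn Solitaire started with $m$ green and $n$ red balls (equivalently, the function determined by the recurrence given in the context). Then $E(1,1)=1$, $E(2,2)=\frac{17}{9}$, $E(3,3)=\frac{143}{50}$, and for all integers $n\ge 1$, $$ -2\bigl(18n^4+159n^3+528n^2+779n+428\bigr)(n+1)^2(n+2)\,E(n,n) $$ $$ +(n+2)\bigl(216n^6+2358n^5+10485n^4+24174n^3+30251n^2+19276n+4800\bigr)\,E(n+1,n+1) $$ $$ +\bigl(-324n^7-4032n^6-21015n^5-59334n^4-97813n^3-93898n^2-48288n-10080\bigr)\,E(n+2,n+2) $$ $$ +2(n+2)\bigl(18n^4+87n^3+159n^2+128n+36\bigr)(2n+5)^2\,E(n+3,n+3)=0 . $$
   Context: Urn Solitaire: an urn contains $m$ green and $n$ red balls. A round consists of drawing balls uniformly at random without replacement, noting the color of the first ball, and continuing to draw until a ball of the other color is drawn; that last ball is returned to the urn. Rounds are repeated, and the game is considered over as soon as the urn contains balls of only one color (or is empty). $E(m,n)$ is the expected number of rounds until the game is over. Equivalently, $E(m,0)=E(0,n)=0$ for all $m,n\ge 0$, and for $m,n\ge 1$, $$E(m,n)=1+\sum_{k=1}^{m}\frac{\binom{m}{k}}{\binom{m+n}{k}}\cdot\frac{n}{m+n-k}\,E(m-k,n)+\sum_{k=1}^{n}\frac{\binom{n}{k}}{\binom{m+n}{k}}\cdot\frac{m}{m+n-k}\,E(m,n-k).$$ -}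

module Defs where

open import Data.Nat as ℕ using (ℕ; zero; suc; _∸_)
open import Data.Nat.Combinatorics using (_C_)
open import Data.Integer as ℤ using (ℤ; +_)
open import Data.Rational using (ℚ; 0ℚ; 1ℚ; _+_; _*_; _/_)
open import Data.List using (List; map; foldr; upTo)

-- The rational number a / d for natural numbers a, d (with the convention
-- a / 0 = 0; this case never occurs in the recurrence below).
frac : ℕ → ℕ → ℚ
frac a zero    = 0ℚ
frac a (suc d) = + a / suc d

sum₁ : ℕ → (ℕ → ℚ) → ℚ
sum₁ m f = foldr _+_ 0ℚ (map (λ i → f (suc i)) (upTo m))

-- Fuel-indexed version of the recurrence.  Every recursive call lowers
-- m + n by at least 1, so fuel m + n is always sufficient.
Ef : ℕ → ℕ → ℕ → ℚ
Ef zero       m       n       = 0ℚ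
Ef (suc fuel) zero    n       = 0ℚ
Ef (suc fuel) (suc m) zero    = 0ℚ
Ef (suc fuel) (suc m) (suc n) =
  1ℚ
  + sum₁ M (λ k → frac (M C k) ((M ℕ.+ N) C k) * frac N (M ℕ.+ N ∸ k) * Ef fuel (M ∸ k) N)
  + sum₁ N (λ k → frac (N C k) ((M ℕ.+ N) C k) * frac M (M ℕ.+ N ∸ k) * Ef fuel M (N ∸ k))
  where
  M = suc m
  N = suc n

E : ℕ → ℕ → ℚ
E m n = Ef (m ℕ.+ n) m n

ι : ℤ → ℚ
ι z = z / 1

{-# OPTIONS --safe #-}
module Submission where

-- Put W(m,n) = C(m+n,n) E(m,n) / (m+n). The recurrence of E turns into a first-order linear PDE for the
-- generating function of W, which becomes (θ_u + θ_v) W = explicit in the variables u = x(1-x), v = y(1-y).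
-- Solving it shows that C(m+n,n) (E(m,n) + 1/2) = (m+n) V(m,n), where V satisfies Pascal's recurrence up to
-- the term 1/(m+n) - 1/(m+n-1). By Pascal induction
--   n V(m,n+1) + m V(m+1,n) = 2(m+n) V(m,n) - C(m+n,n) - 1/(m+n+1),
-- and with Σ_{1≤j<m} V(j,n) = V(m,n+1) - V(m,n) - 1/(m+n+1) this gives back the recurrence of E. On the diagonal
-- it yields a first-order inhomogeneous recurrence
--   n(2n+1)² C(2n,n) (E(n+1,n+1) + 1/2) = 2(n+1)²(2n+1) C(2n,n) E(n,n) - (n+1)(3n+2)/2,
-- and a combination of three consecutive instances eliminates the inhomogeneous part.

open import Defs
open import Data.Nat using (ℕ; _≥_) renaming (_+_ to _+ℕ_)
open import Data.Integer using (ℤ; +_; -_) renaming (_+_ to _+ℤ_; _*_ to _*ℤ_; _^_ to _^ℤ_)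
open import Data.Product using (_×_)
open import Data.Rational using (ℚ; 0ℚ; 1ℚ; _+_; _*_; _/_)
open import Relation.Binary.PropositionalEquality using (_≡_)

open import Data.Nat using (zero; suc; _∸_; _!; _<_; s≤s; z≤n; NonZero; ≢-nonZero; ≢-nonZero⁻¹) renaming (_*_ to _*ℕ_; _≤_ to _≤ℕ_)
import Data.Nat.Properties as ℕₚ
open import Data.Nat.Properties using (_!≢0; _!*_!≢0)
open import Data.Nat.Combinatorics using (_C_; nCn≡1; nCk+nC[k+1]≡[n+1]C[k+1])
open import Data.Nat.Tactic.RingSolver using () renaming (solve-∀ to solveℕ-∀)
open import Data.Integer.Tactic.RingSolver using () renaming (solve-∀ to solveℤ-∀)
import Data.Integer.Properties as ℤₚ
open import Data.List using ([]; _∷_; foldr; map; upTo; applyUpTo)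
open import Data.List.Properties using (map-applyUpTo)
open import Data.Product using (_,_; proj₁; proj₂)
open import Data.Rational using (½; _-_; toℚᵘ) renaming (-_ to infix 8 -ℚ_)
open import Data.Rational.Properties as ℚₚ using (+-*-commutativeRing; toℚᵘ-injective; toℚᵘ-fromℚᵘ; toℚᵘ-homo-+; toℚᵘ-homo-*)
open import Algebra.Properties.Group ℚₚ.+-0-group using (∙-cancelʳ)
open import Data.Rational.Unnormalised using (mkℚᵘ; *≡*; _≃_)
import Data.Rational.Unnormalised as ℚᵘ
import Data.Rational.Unnormalised.Properties as ℚᵘₚ
open import Relation.Binary.PropositionalEquality using (refl; sym; trans; cong; cong₂; subst; module ≡-Reasoning)
open import Relation.Nullary.Decidable using (dec⇒maybe)
open import Tactic.RingSolver using (solve)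
open import Tactic.RingSolver.Core.AlmostCommutativeRing using (AlmostCommutativeRing; fromCommutativeRing)

-- Ring solving and linear combinations of equations over ℚ

ℚ-ring : AlmostCommutativeRing _ _
ℚ-ring = fromCommutativeRing +-*-commutativeRing (λ x → dec⇒maybe (0ℚ ℚₚ.≟ x))

open AlmostCommutativeRing ℚ-ring using (_^_)

-- With _·_ and _⊕_: a - b is the given linear combination of (left - right) of known equations.
cancel-combination : ∀ {a b l r : ℚ} → l ≡ r → a + r ≡ b + l → a ≡ b
cancel-combination {a} {b} {l} {r} l≡r eq =
  ∙-cancelʳ r a b (trans eq (cong (_+_ b) l≡r))

infixr 6 _⊕_
infix 7 _·_

_⊕_ : ∀ {a b c d : ℚ} → a ≡ b → c ≡ d → a + c ≡ b + d
_⊕_ = cong₂ _+_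

_·_ : ∀ c {a b : ℚ} → a ≡ b → c * a ≡ c * b
c · eq = cong (c *_) eq

-- Embedding of integers and naturals into ℚ

toℚᵘ-/ : ∀ i d → toℚᵘ (i / suc d) ≃ mkℚᵘ i d
toℚᵘ-/ i d = toℚᵘ-fromℚᵘ (mkℚᵘ i d)

-- Division in ℚ normalises by a gcd, which is stuck on variables; unnormalised fractions reduce the
-- claim to an integer identity.
ι-+ : ∀ i j → ι (i +ℤ j) ≡ ι i + ι j
ι-+ i j = toℚᵘ-injective (begin
  toℚᵘ (ι (i +ℤ j))          ≈⟨ toℚᵘ-/ (i +ℤ j) 0 ⟩
  mkℚᵘ (i +ℤ j) 0            ≈⟨ *≡* (identity i j) ⟩
  mkℚᵘ i 0 ℚᵘ.+ mkℚᵘ j 0     ≈⟨ ℚᵘₚ.+-cong (toℚᵘ-/ i 0) (toℚᵘ-/ j 0) ⟨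
  toℚᵘ (ι i) ℚᵘ.+ toℚᵘ (ι j) ≈⟨ toℚᵘ-homo-+ (ι i) (ι j) ⟨
  toℚᵘ (ι i + ι j)           ∎)
  where
  open ℚᵘₚ.≃-Reasoning
  identity : ∀ i j → (i +ℤ j) *ℤ + 1 ≡ (i *ℤ + 1 +ℤ j *ℤ + 1) *ℤ + 1
  identity = solveℤ-∀

/-*-/ : ∀ i j d e k → i *ℤ j *ℤ + 1 ≡ k *ℤ + (suc d *ℕ suc e) → (i / suc d) * (j / suc e) ≡ ι k
/-*-/ i j d e k eq = toℚᵘ-injective (begin
  toℚᵘ ((i / suc d) * (j / suc e)) ≈⟨ toℚᵘ-homo-* (i / suc d) (j / suc e) ⟩
  toℚᵘ (i / suc d) ℚᵘ.* toℚᵘ (j / suc e) ≈⟨ ℚᵘₚ.*-cong (toℚᵘ-/ i d) (toℚᵘ-/ j e) ⟩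
  mkℚᵘ i d ℚᵘ.* mkℚᵘ j e ≈⟨ *≡* eq ⟩
  mkℚᵘ k 0 ≈⟨ toℚᵘ-/ k 0 ⟨
  toℚᵘ (ι k) ∎)
  where open ℚᵘₚ.≃-Reasoning

ι-* : ∀ i j → ι (i *ℤ j) ≡ ι i * ι j
ι-* i j = sym (/-*-/ i j 0 0 (i *ℤ j) refl)

κ : ℕ → ℚ
κ n = ι (+ n)

-- Opaque copy of κ for symbolic arguments, on which ι would otherwise unfold down to its gcd computation;
-- κ stays transparent so that the ring solver can evaluate numerals.
opaque
  q : ℕ → ℚ
  q = κ

  q≡κ : ∀ n → q n ≡ κ n
  q≡κ n = refl

  q-+ : ∀ m n → q (m +ℕ n) ≡ q m + q n
  q-+ m n = ι-+ (+ m) (+ n)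

  q-κ+ : ∀ k n → q (k +ℕ n) ≡ κ k + q n
  q-κ+ = q-+

  q-* : ∀ m n → q (m *ℕ n) ≡ q m * q n
  q-* m n = trans (cong ι (ℤₚ.pos-* m n)) (ι-* (+ m) (+ n))

  frac-* : ∀ a d .{{_ : NonZero d}} → frac a d * q d ≡ q a
  frac-* a (suc d) = /-*-/ (+ a) (+ suc d) d 0 (+ a)
    (trans (ℤₚ.*-identityʳ (+ a *ℤ + suc d)) (cong (λ k → + a *ℤ + k) (sym (ℕₚ.*-identityʳ (suc d)))))

q-cancelˡ : ∀ d .{{_ : NonZero d}} {a b} → q d * a ≡ q d * b → a ≡ b
q-cancelˡ d {a} {b} eq = cancel-combination (frac 1 d · eq ⊕ (b - a) · trans (frac-* 1 d) (q≡κ 1)) (identity (frac 1 d) (q d) a b)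
  where
  identity : ∀ r s a b → a + (r * (s * b) + (b - a) * 1ℚ) ≡ b + (r * (s * a) + (b - a) * (r * s))
  identity r s a b = solve (r ∷ s ∷ a ∷ b ∷ []) ℚ-ring

-- Binomial coefficients

-- This is C(a+b,a), indexed by the two parts so that Pascal's rule and symmetry involve no
-- truncated subtraction.
bin : ℕ → ℕ → ℕ
bin zero    b       = 1
bin (suc a) zero    = 1
bin (suc a) (suc b) = bin a (suc b) +ℕ bin (suc a) b

bin-comm : ∀ a b → bin a b ≡ bin b a
bin-comm zero    zero    = refl
bin-comm zero    (suc b) = refl
bin-comm (suc a) zero    = refl
bin-comm (suc a) (suc b) = trans (cong₂ _+ℕ_ (bin-comm a (suc b)) (bin-comm (suc a) b)) (ℕₚ.+-comm (bin (suc b) a) _)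

bin≢0 : ∀ a b → NonZero (bin a b)
bin≢0 zero    b       = _
bin≢0 (suc a) zero    = _
bin≢0 (suc a) (suc b) = ≢-nonZero (λ eq → ≢-nonZero⁻¹ (bin a (suc b)) {{bin≢0 a (suc b)}} (ℕₚ.m+n≡0⇒m≡0 _ eq))

-- By Pascal's rule the two predecessors contribute (a+1) and (b+1) times the same factorial
-- (a+b+1)!, and these weights add up to the missing factor.
bin-factorial : ∀ a b → bin a b *ℕ (a ! *ℕ b !) ≡ (a +ℕ b) !
bin-factorial zero b = trans (ℕₚ.*-identityˡ (1 *ℕ b !)) (ℕₚ.*-identityˡ (b !))
bin-factorial (suc a) zero = begin
  1 *ℕ (suc a ! *ℕ 1)  ≡⟨ ℕₚ.*-identityˡ (suc a ! *ℕ 1) ⟩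
  suc a ! *ℕ 1         ≡⟨ ℕₚ.*-identityʳ (suc a !) ⟩
  suc a !              ≡⟨ cong _! (ℕₚ.+-identityʳ (suc a)) ⟨
  (suc a +ℕ 0) !       ∎
  where open ≡-Reasoning
bin-factorial (suc a) (suc b) = begin
  (bin a (suc b) +ℕ bin (suc a) b) *ℕ (suc a *ℕ a ! *ℕ (suc b *ℕ b !))
    ≡⟨ distribute (bin a (suc b)) (bin (suc a) b) (suc a) (a !) (suc b) (b !) ⟩
  suc a *ℕ (bin a (suc b) *ℕ (a ! *ℕ suc b !)) +ℕ suc b *ℕ (bin (suc a) b *ℕ (suc a ! *ℕ b !))
    ≡⟨ cong₂ (λ u v → suc a *ℕ u +ℕ suc b *ℕ v) (bin-factorial a (suc b))
         (trans (bin-factorial (suc a) b) (cong _! (sym (ℕₚ.+-suc a b)))) ⟩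
  suc a *ℕ (a +ℕ suc b) ! +ℕ suc b *ℕ (a +ℕ suc b) !
    ≡⟨ ℕₚ.*-distribʳ-+ ((a +ℕ suc b) !) (suc a) (suc b) ⟨
  (suc a +ℕ suc b) ! ∎
  where
  open ≡-Reasoning
  distribute : ∀ p r m a! n b! →
    (p +ℕ r) *ℕ (m *ℕ a! *ℕ (n *ℕ b!)) ≡ m *ℕ (p *ℕ (a! *ℕ (n *ℕ b!))) +ℕ n *ℕ (r *ℕ (m *ℕ a! *ℕ b!))
  distribute = solveℕ-∀

C≡bin : ∀ a b → (a +ℕ b) C a ≡ bin a b
C≡bin zero    b       = refl
C≡bin (suc a) zero    = trans (cong (_C suc a) (ℕₚ.+-identityʳ (suc a))) (nCn≡1 (suc a))
C≡bin (suc a) (suc b) = begin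
  suc (a +ℕ suc b) C suc a                     ≡⟨ nCk+nC[k+1]≡[n+1]C[k+1] (a +ℕ suc b) a ⟨
  (a +ℕ suc b) C a +ℕ (a +ℕ suc b) C suc a     ≡⟨ cong₂ _+ℕ_ (C≡bin a (suc b)) (trans (cong (_C suc a) (ℕₚ.+-suc a b)) (C≡bin (suc a) b)) ⟩
  bin a (suc b) +ℕ bin (suc a) b               ∎
  where open ≡-Reasoning

-- Multiplied by a! b!, both sides are (a+b+1)!.
bin-absorb : ∀ a b → bin a (suc b) *ℕ suc b ≡ suc (a +ℕ b) *ℕ bin a b
bin-absorb a b = ℕₚ.*-cancelʳ-≡ _ _ (a ! *ℕ b !) {{a !* b !≢0}} (begin
  bin a (suc b) *ℕ suc b *ℕ (a ! *ℕ b !)     ≡⟨ regroup (bin a (suc b)) (suc b) (a !) (b !) ⟩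
  bin a (suc b) *ℕ (a ! *ℕ suc b !)          ≡⟨ bin-factorial a (suc b) ⟩
  (a +ℕ suc b) !                             ≡⟨ cong _! (ℕₚ.+-suc a b) ⟩
  suc (a +ℕ b) *ℕ (a +ℕ b) !                 ≡⟨ cong (suc (a +ℕ b) *ℕ_) (bin-factorial a b) ⟨
  suc (a +ℕ b) *ℕ (bin a b *ℕ (a ! *ℕ b !))  ≡⟨ ℕₚ.*-assoc (suc (a +ℕ b)) (bin a b) _ ⟨
  suc (a +ℕ b) *ℕ bin a b *ℕ (a ! *ℕ b !)    ∎)
  where
  open ≡-Reasoning
  regroup : ∀ p n a! b! → p *ℕ n *ℕ (a! *ℕ b!) ≡ p *ℕ (a! *ℕ (n *ℕ b!))
  regroup = solveℕ-∀

-- Both sides are the trinomial coefficient of a, b, c: multiplied by a! b! c! they give (a+b+c)!.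
bin-trinomial : ∀ a b c → bin (a +ℕ b) c *ℕ bin b a ≡ bin a c *ℕ bin b (a +ℕ c)
bin-trinomial a b c = ℕₚ.*-cancelʳ-≡ _ _ (a ! *ℕ b ! *ℕ c !) {{nonZero}} (begin
  bin (a +ℕ b) c *ℕ bin b a *ℕ (a ! *ℕ b ! *ℕ c !)
    ≡⟨ regroup₁ (bin (a +ℕ b) c) (bin b a) (a !) (b !) (c !) ⟩
  bin (a +ℕ b) c *ℕ (bin b a *ℕ (b ! *ℕ a !) *ℕ c !)
    ≡⟨ cong (λ k → bin (a +ℕ b) c *ℕ (k *ℕ c !)) (trans (bin-factorial b a) (cong _! (ℕₚ.+-comm b a))) ⟩
  bin (a +ℕ b) c *ℕ ((a +ℕ b) ! *ℕ c !)
    ≡⟨ bin-factorial (a +ℕ b) c ⟩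
  (a +ℕ b +ℕ c) !
    ≡⟨ cong _! (rotate a b c) ⟩
  (b +ℕ (a +ℕ c)) !
    ≡⟨ bin-factorial b (a +ℕ c) ⟨
  bin b (a +ℕ c) *ℕ (b ! *ℕ (a +ℕ c) !)
    ≡⟨ cong (λ k → bin b (a +ℕ c) *ℕ (b ! *ℕ k)) (bin-factorial a c) ⟨
  bin b (a +ℕ c) *ℕ (b ! *ℕ (bin a c *ℕ (a ! *ℕ c !)))
    ≡⟨ regroup₂ (bin a c) (bin b (a +ℕ c)) (a !) (b !) (c !) ⟩
  bin a c *ℕ bin b (a +ℕ c) *ℕ (a ! *ℕ b ! *ℕ c !) ∎)
  where
  open ≡-Reasoning
  nonZero : NonZero (a ! *ℕ b ! *ℕ c !)
  nonZero = ℕₚ.m*n≢0 (a ! *ℕ b !) (c !) {{a !* b !≢0}} {{c !≢0}}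
  rotate : ∀ a b c → a +ℕ b +ℕ c ≡ b +ℕ (a +ℕ c)
  rotate = solveℕ-∀
  regroup₁ : ∀ p r a! b! c! → p *ℕ r *ℕ (a! *ℕ b! *ℕ c!) ≡ p *ℕ (r *ℕ (b! *ℕ a!) *ℕ c!)
  regroup₁ = solveℕ-∀
  regroup₂ : ∀ p r a! b! c! → r *ℕ (b! *ℕ (p *ℕ (a! *ℕ c!))) ≡ p *ℕ r *ℕ (a! *ℕ b! *ℕ c!)
  regroup₂ = solveℕ-∀

-- The array V and its cross identity

-- r n is 1/(n+1).
opaque
  r : ℕ → ℚ
  r n = frac 1 (suc n)

  r-inverse : ∀ n → r n * q (suc n) ≡ 1ℚ
  r-inverse n = trans (frac-* 1 (suc n)) (q≡κ 1)

-- V a b is the V(a+1,b+1) of the header; likewise in Cross and ClosedForm.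
V : ℕ → ℕ → ℚ
V zero    zero    = + 3 / 2
V (suc a) zero    = V a zero + r (2 +ℕ a)
V zero    (suc b) = V zero b + r (2 +ℕ b)
V (suc a) (suc b) = V a (suc b) + V (suc a) b + (r (3 +ℕ (a +ℕ b)) - r (2 +ℕ (a +ℕ b)))

V-comm : ∀ a b → V a b ≡ V b a
V-comm zero    zero    = refl
V-comm zero    (suc b) = cong (_+ r (2 +ℕ b)) (V-comm zero b)
V-comm (suc a) zero    = cong (_+ r (2 +ℕ a)) (V-comm a zero)
V-comm (suc a) (suc b) = cong₂ _+_
  (trans (cong₂ _+_ (V-comm a (suc b)) (V-comm (suc a) b)) (ℚₚ.+-comm (V (suc b) a) (V b (suc a))))
  (cong (λ k → r (3 +ℕ k) - r (2 +ℕ k)) (ℕₚ.+-comm a b))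

Cross : ℕ → ℕ → Set
Cross a b = q (suc b) * V a (suc b) + q (suc a) * V (suc a) b
              + (q (bin (suc a) (suc b)) + r (2 +ℕ (a +ℕ b)))
            ≡ κ 2 * (q (2 +ℕ (a +ℕ b)) * V a b)

Cross-sym : ∀ a b → Cross a b → Cross b a
Cross-sym a b eq
  rewrite V-comm b a | V-comm b (suc a) | V-comm (suc b) a | bin-comm (suc b) (suc a) | ℕₚ.+-comm b a =
  trans (cong (_+ (q (bin (suc a) (suc b)) + r (2 +ℕ (a +ℕ b)))) (ℚₚ.+-comm (q (suc a) * V (suc a) b) (q (suc b) * V a (suc b)))) eq

q-linear : ∀ k a b → q (k +ℕ (a +ℕ b)) ≡ κ k + (q a + q b)
q-linear k a b = trans (q-κ+ k (a +ℕ b)) (cong (_+_ (κ k)) (q-+ a b))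

-- The edge clauses of `V` are its Pascal recurrence with boundary value V(m,0) = 1/m absorbed, so
-- one smaller instance suffices.
V-cross-edge : ∀ a → Cross a 0 → Cross (suc a) 0
V-cross-edge a hyp with a +ℕ 0 | ℕₚ.+-identityʳ a
... | .a | refl = go {q a} {V a 0} {V a 1} {q (bin (suc a) 1)} {r (2 +ℕ a)} {r (3 +ℕ a)}
  (q-κ+ 1 a) (q-κ+ 2 a) (q-κ+ 3 a) (q-κ+ 4 a)
  (trans (q-+ (bin (suc a) 1) 1) (cong (_+_ (q (bin (suc a) 1))) (q≡κ 1))) (q≡κ 1) hyp (r-inverse (2 +ℕ a)) (r-inverse (3 +ℕ a))
  where
  -- All quantities become variables, and matching on `refl` substitutes the shifted ones, so that
  -- the solver sees only polynomials. The later `go` lemmas follow the same pattern.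
  go : ∀ {A v p β r₂ r₃ q1 q2 q3 q4 β' u} →
    q1 ≡ κ 1 + A → q2 ≡ κ 2 + A → q3 ≡ κ 3 + A → q4 ≡ κ 4 + A → β' ≡ β + κ 1 → u ≡ κ 1 →
    u * p + q1 * (v + r₂) + (β + r₂) ≡ κ 2 * (q2 * v) →
    r₂ * q3 ≡ 1ℚ → r₃ * q4 ≡ 1ℚ →
    u * (p + (v + r₂) + (r₃ - r₂)) + q2 * (v + r₂ + r₃) + (β' + r₃) ≡ κ 2 * (q3 * (v + r₂))
  go {A} {v} {p} {β} {r₂} {r₃} refl refl refl refl refl refl hyp e₂ e₃ =
    cancel-combination (hyp ⊕ e₃ ⊕ -ℚ κ 2 · e₂) (solve (A ∷ v ∷ p ∷ β ∷ r₂ ∷ r₃ ∷ []) ℚ-ring)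

-- The sum of the two predecessor instances is the target up to 2W on each side and the reciprocals.
-- The latter form products `r j * q (suc j)`, each equal to 1, with weights 2, -3 and 1 that sum to
-- zero.
V-cross-step : ∀ a b → Cross a (suc b) → Cross (suc a) b → Cross (suc a) (suc b)
V-cross-step a b hyp₁ hyp₂ with a +ℕ suc b | ℕₚ.+-suc a b
... | .(suc (a +ℕ b)) | refl =
  go {q a} {q b} {V a (suc (suc b))} {V (suc (suc a)) b} {V a (suc b)} {V (suc a) b}
     {q (bin (suc a) (suc (suc b)))} {q (bin (suc (suc a)) (suc b))} {r (2 +ℕ (a +ℕ b))} {r (3 +ℕ (a +ℕ b))} {r (4 +ℕ (a +ℕ b))}
     (q-κ+ 1 a) (q-κ+ 2 a) (q-κ+ 1 b) (q-κ+ 2 b) (q-linear 3 a b) (q-linear 4 a b) (q-linear 5 a b)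
     (q-+ (bin (suc a) (suc (suc b))) (bin (suc (suc a)) (suc b)))
     hyp₁ hyp₂ (r-inverse (2 +ℕ (a +ℕ b))) (r-inverse (3 +ℕ (a +ℕ b))) (r-inverse (4 +ℕ (a +ℕ b)))
  where
  go : ∀ {A B X Y Z T β₁ β₂ r₂ r₃ r₄ a1 a2 b1 b2 s3 s4 s5 β} →
    a1 ≡ κ 1 + A → a2 ≡ κ 2 + A → b1 ≡ κ 1 + B → b2 ≡ κ 2 + B →
    s3 ≡ κ 3 + (A + B) → s4 ≡ κ 4 + (A + B) → s5 ≡ κ 5 + (A + B) → β ≡ β₁ + β₂ →
    let W = Z + T + (r₃ - r₂) in
    b2 * X + a1 * W + (β₁ + r₃) ≡ κ 2 * (s3 * Z) →
    b1 * W + a2 * Y + (β₂ + r₃) ≡ κ 2 * (s3 * T) →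
    r₂ * s3 ≡ 1ℚ → r₃ * s4 ≡ 1ℚ → r₄ * s5 ≡ 1ℚ →
    b2 * (X + W + (r₄ - r₃)) + a2 * (W + Y + (r₄ - r₃)) + (β + r₄) ≡ κ 2 * (s4 * W)
  go {A} {B} {X} {Y} {Z} {T} {β₁} {β₂} {r₂} {r₃} {r₄} refl refl refl refl refl refl refl refl hyp₁ hyp₂ e₂ e₃ e₄ =
    cancel-combination (hyp₁ ⊕ hyp₂ ⊕ κ 2 · e₂ ⊕ -ℚ κ 3 · e₃ ⊕ e₄)
      (solve (A ∷ B ∷ X ∷ Y ∷ Z ∷ T ∷ β₁ ∷ β₂ ∷ r₂ ∷ r₃ ∷ r₄ ∷ []) ℚ-ring)

opaque
  unfolding q r
  V-cross-origin : Cross 0 0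
  V-cross-origin = refl

V-cross : ∀ a b → Cross a b
V-cross zero    zero    = V-cross-origin
V-cross (suc a) zero    = V-cross-edge a (V-cross a zero)
V-cross zero    (suc b) = Cross-sym (suc b) zero (V-cross-edge b (Cross-sym zero b (V-cross zero b)))
V-cross (suc a) (suc b) = V-cross-step a b (V-cross a (suc b)) (V-cross (suc a) b)

-- Evaluating the sums of the recurrence

-- The largest index comes first, so the k-th summand of `sum₁` meets index n - k without
-- reordering.
sumBelow : ℕ → (ℕ → ℚ) → ℚ
sumBelow zero    g = 0ℚ
sumBelow (suc n) g = g n + sumBelow n g

foldr-map-upTo : ∀ f n → foldr _+_ 0ℚ (map f (upTo n)) ≡ foldr _+_ 0ℚ (applyUpTo f n)
foldr-map-upTo f n = cong (foldr _+_ 0ℚ) (map-applyUpTo (λ i → i) f n)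

sum₁-reverse : ∀ c n f g → (∀ j k → j +ℕ suc k ≡ n → c * f (suc k) ≡ g j) → c * sum₁ n f ≡ sumBelow n g
sum₁-reverse c n f g h = trans (cong (c *_) (foldr-map-upTo (λ i → f (suc i)) n)) (go n (λ i → f (suc i)) h)
  where
  go : ∀ n f → (∀ j k → j +ℕ suc k ≡ n → c * f k ≡ g j) → c * foldr _+_ 0ℚ (applyUpTo f n) ≡ sumBelow n g
  go zero    f h = ℚₚ.*-zeroʳ c
  go (suc n) f h = trans (ℚₚ.*-distribˡ-+ c (f 0) _)
    (cong₂ _+_ (h n 0 (ℕₚ.+-comm n 1))
               (go n (λ i → f (suc i)) (λ j k eq → h j (suc k) (trans (ℕₚ.+-suc j (suc k)) (cong suc eq)))))

-- C(M+N,N) times the k-th summand of the first sum in Ef, where N = b+1 and the second argument is M - k.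
term : ℕ → ℕ → ℚ
term b zero    = 0ℚ
term b (suc i) = q (suc b) * V i b - ½ * q (bin (suc i) b)

-- Pascal's recurrence telescopes the `V` part, and the binomial part is a hockey-stick sum. The
-- `- 1ℚ` removes the index 0 of that sum, since the term there is 0 and not the general formula.
sum-term : ∀ a b → sumBelow (suc a) (term b) ≡
  q (suc b) * (V a (suc b) - V a b - r (2 +ℕ (a +ℕ b))) - ½ * (q (bin a (suc b)) - 1ℚ)
sum-term zero    b = identity (q (suc b)) (V 0 b) (r (2 +ℕ b)) (q≡κ 1)
  where
  identity : ∀ n v r₂ {u} → u ≡ 1ℚ → 0ℚ + 0ℚ ≡ n * (v + r₂ - v - r₂) - ½ * (u - 1ℚ)
  identity n v r₂ refl = solve (n ∷ v ∷ r₂ ∷ []) ℚ-ring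
sum-term (suc a) b = trans (cong (_+_ (term b (suc a))) (sum-term a b))
  (trans (identity (q (suc b)) (V a b) (V a (suc b)) (V (suc a) b) (r (2 +ℕ (a +ℕ b))) (r (3 +ℕ (a +ℕ b))) (q (bin a (suc b))) (q (bin (suc a) b)))
         (cong (λ β → q (suc b) * (V (suc a) (suc b) - V (suc a) b - r (3 +ℕ (a +ℕ b))) - ½ * (β - 1ℚ))
               (sym (q-+ (bin a (suc b)) (bin (suc a) b)))))
  where
  identity : ∀ n v x y r₂ r₃ β₁ β₂ →
    n * v - ½ * β₂ + (n * (x - v - r₂) - ½ * (β₁ - 1ℚ))
    ≡ n * (x + y + (r₃ - r₂) - y - r₃) - ½ * (β₁ + β₂ - 1ℚ)
  identity n v x y r₂ r₃ β₁ β₂ = solve (n ∷ v ∷ x ∷ y ∷ r₂ ∷ r₃ ∷ β₁ ∷ β₂ ∷ []) ℚ-ring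

-- This removes the ratio of binomials from the recurrence: after scaling, a summand depends on k
-- only through j = M - k. With the denominator `D` cleared it is `bin-trinomial`.
bin-frac : ∀ j k n → q (bin (j +ℕ k) n) * frac ((j +ℕ k) C k) ((j +ℕ k +ℕ n) C k) ≡ q (bin j n)
bin-frac j k n rewrite ℕₚ.+-comm j k | ℕₚ.+-assoc k j n | C≡bin k j | C≡bin k (j +ℕ n) =
  q-cancelˡ D {{bin≢0 k (j +ℕ n)}} (begin
  q D * (q B * frac (bin k j) D)   ≡⟨ swap (q D) (q B) (frac (bin k j) D) ⟩
  q B * (frac (bin k j) D * q D)   ≡⟨ cong (q B *_) (frac-* (bin k j) D {{bin≢0 k (j +ℕ n)}}) ⟩
  q B * q (bin k j)                ≡⟨ q-* B (bin k j) ⟨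
  q (B *ℕ bin k j)                 ≡⟨ cong q (trans (cong (λ m → bin m n *ℕ bin k j) (ℕₚ.+-comm k j)) (bin-trinomial j k n)) ⟩
  q (bin j n *ℕ D)                 ≡⟨ cong q (ℕₚ.*-comm (bin j n) D) ⟩
  q (D *ℕ bin j n)                 ≡⟨ q-* D (bin j n) ⟩
  q D * q (bin j n)                ∎)
  where
  open ≡-Reasoning
  B = bin (k +ℕ j) n
  D = bin k (j +ℕ n)
  swap : ∀ d β f → d * (β * f) ≡ β * (f * d)
  swap d β f = solve (d ∷ β ∷ f ∷ []) ℚ-ring

-- Closed form of E in terms of V

-- The value `e` is arbitrary because the induction needs the formula for `Ef` at varying fuel.
ClosedForm : ℕ → ℕ → ℚ → Set
ClosedForm a b e = q (bin (suc a) (suc b)) * (e + ½) ≡ q (2 +ℕ (a +ℕ b)) * V a b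

ClosedForm-sym : ∀ a b e → ClosedForm a b e → ClosedForm b a e
ClosedForm-sym a b e eq rewrite bin-comm (suc b) (suc a) | ℕₚ.+-comm b a | V-comm b a = eq

-- The factor N/(j+N) cancels the j+N in front of `V`, and by absorption it turns the ½ C(j+N,N)
-- into ½ C(j+N-1,N-1), where j = i+1 and N = b+1.
term-value : ∀ i b e → ClosedForm i b e →
  q (bin (suc i) (suc b)) * (frac (suc b) (suc i +ℕ suc b) * e) ≡ term b (suc i)
term-value i b e formula with i +ℕ suc b | ℕₚ.+-suc i b
... | .(suc (i +ℕ b)) | refl = go {q β} {e} {q s} {V i b} {y} formula (frac-* (suc b) s) (q-cancelˡ s (begin
  q s * (y * q β)              ≡⟨ swap (q s) y (q β) ⟩
  q β * (y * q s)              ≡⟨ cong (q β *_) (frac-* (suc b) s) ⟩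
  q β * q (suc b)              ≡⟨ q-* β (suc b) ⟨
  q (β *ℕ suc b)               ≡⟨ cong q (bin-absorb (suc i) b) ⟩
  q (s *ℕ bin (suc i) b)       ≡⟨ q-* s (bin (suc i) b) ⟩
  q s * q (bin (suc i) b)      ∎))
  where
  open ≡-Reasoning
  s = 2 +ℕ (i +ℕ b)
  y = frac (suc b) s
  β = bin (suc i) (suc b)
  swap : ∀ d y β → d * (y * β) ≡ β * (y * d)
  swap d y β = solve (d ∷ y ∷ β ∷ []) ℚ-ring
  go : ∀ {β e s v y n β'} → β * (e + ½) ≡ s * v → y * s ≡ n → y * β ≡ β' → β * (y * e) ≡ n * v - ½ * β'
  go {β} {e} {s} {v} {y} hyp refl refl =
    cancel-combination (y · hyp) (solve (β ∷ e ∷ s ∷ v ∷ y ∷ []) ℚ-ring)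

-- `X` is E along either coordinate, so both sums are covered; `T` is kept apart from `M +ℕ suc b`
-- because the second sum has its total in the other order.
summand-value : ∀ b j k {M T} (X : ℕ → ℚ) → j +ℕ suc k ≡ M → M +ℕ suc b ≡ T →
  X 0 ≡ 0ℚ → (∀ i → suc i < M → ClosedForm i b (X (suc i))) →
  q (bin M (suc b)) * (frac (M C suc k) (T C suc k) * frac (suc b) (T ∸ suc k) * X (M ∸ suc k)) ≡ term b j
summand-value b j k X refl refl X0 X+ = begin
  β * (f * frac (suc b) (M +ℕ suc b ∸ suc k) * X (M ∸ suc k))
    ≡⟨ cong₂ (λ d i → β * (f * frac (suc b) d * X i)) total (ℕₚ.m+n∸n≡m j (suc k)) ⟩
  β * (f * frac (suc b) (j +ℕ suc b) * X j)
    ≡⟨ regroup β f (frac (suc b) (j +ℕ suc b)) (X j) ⟩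
  β * f * (frac (suc b) (j +ℕ suc b) * X j)
    ≡⟨ cong (_* (frac (suc b) (j +ℕ suc b) * X j)) (bin-frac j (suc k) (suc b)) ⟩
  q (bin j (suc b)) * (frac (suc b) (j +ℕ suc b) * X j)
    ≡⟨ value j (ℕₚ.m<m+n j (s≤s z≤n)) ⟩
  term b j ∎
  where
  open ≡-Reasoning
  M = j +ℕ suc k
  β = q (bin M (suc b))
  f = frac (M C suc k) ((M +ℕ suc b) C suc k)
  rotate : ∀ j k b → j +ℕ k +ℕ b ≡ j +ℕ b +ℕ k
  rotate = solveℕ-∀
  total : M +ℕ suc b ∸ suc k ≡ j +ℕ suc b
  total = trans (cong (_∸ suc k) (rotate j (suc k) (suc b))) (ℕₚ.m+n∸n≡m (j +ℕ suc b) (suc k))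
  regroup : ∀ β f g x → β * (f * g * x) ≡ β * f * (g * x)
  regroup β f g x = solve (β ∷ f ∷ g ∷ x ∷ []) ℚ-ring
  zeros : ∀ β y → β * (y * 0ℚ) ≡ 0ℚ
  zeros β y = solve (β ∷ y ∷ []) ℚ-ring
  value : ∀ j → j < M → q (bin j (suc b)) * (frac (suc b) (j +ℕ suc b) * X j) ≡ term b j
  value zero    _   = trans (cong (λ x → q 1 * (frac (suc b) (suc b) * x)) X0) (zeros (q 1) (frac (suc b) (suc b)))
  value (suc i) i<M = term-value i b (X (suc i)) (X+ i i<M)

Ef-zeroˡ : ∀ fuel n → Ef fuel 0 n ≡ 0ℚ
Ef-zeroˡ zero       n = refl
Ef-zeroˡ (suc fuel) n = refl

Ef-zeroʳ : ∀ fuel m → Ef fuel m 0 ≡ 0ℚ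
Ef-zeroʳ zero       m       = refl
Ef-zeroʳ (suc fuel) zero    = refl
Ef-zeroʳ (suc fuel) (suc m) = refl

-- The two sums bring in exactly the neighbours V(m,n+1) and V(m+1,n) that `V-cross` expresses by
-- V(m,n). The binomial parts add up to -3/2 C(m+n,n), matching 1 + ½ on the left, and the constants
-- cancel against (m+n+1) times 1/(m+n+1).
ClosedForm-from-sums : ∀ a b S₁ S₂ →
  q (bin (suc a) (suc b)) * S₁ ≡ sumBelow (suc a) (term b) →
  q (bin (suc b) (suc a)) * S₂ ≡ sumBelow (suc b) (term a) →
  ClosedForm a b (1ℚ + S₁ + S₂)
ClosedForm-from-sums a b S₁ S₂ eq₁ eq₂ =
  go {q a} {q b} {_} {q (bin a (suc b))} {q (bin (suc a) b)} {V a b} {V a (suc b)} {V (suc a) b} {r (2 +ℕ (a +ℕ b))} {S₁} {S₂}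
     (q-κ+ 1 a) (q-κ+ 1 b) (q-linear 2 a b) (q-linear 3 a b) (q-+ (bin a (suc b)) (bin (suc a) b))
     (trans eq₁ (sum-term a b)) (flipped (trans eq₂ (sum-term b a))) (V-cross a b) (r-inverse (2 +ℕ (a +ℕ b)))
  where
  flipped : q (bin (suc b) (suc a)) * S₂ ≡ q (suc a) * (V b (suc a) - V b a - r (2 +ℕ (b +ℕ a))) - ½ * (q (bin b (suc a)) - 1ℚ) →
            q (bin (suc a) (suc b)) * S₂ ≡ q (suc a) * (V (suc a) b - V a b - r (2 +ℕ (a +ℕ b))) - ½ * (q (bin (suc a) b) - 1ℚ)
  flipped eq rewrite bin-comm (suc b) (suc a) | bin-comm b (suc a) | V-comm b (suc a) | V-comm b a | ℕₚ.+-comm b a = eq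
  go : ∀ {A B c c₁ c₂ v x y r₂ S₁ S₂ a1 b1 s2 s3} →
    a1 ≡ κ 1 + A → b1 ≡ κ 1 + B → s2 ≡ κ 2 + (A + B) → s3 ≡ κ 3 + (A + B) → c ≡ c₁ + c₂ →
    c * S₁ ≡ b1 * (x - v - r₂) - ½ * (c₁ - 1ℚ) →
    c * S₂ ≡ a1 * (y - v - r₂) - ½ * (c₂ - 1ℚ) →
    b1 * x + a1 * y + (c + r₂) ≡ κ 2 * (s2 * v) →
    r₂ * s3 ≡ 1ℚ →
    c * (1ℚ + S₁ + S₂ + ½) ≡ s2 * v
  go {A} {B} {_} {c₁} {c₂} {v} {x} {y} {r₂} {S₁} {S₂} refl refl refl refl refl eq₁ eq₂ cross e₂ =
    cancel-combination (eq₁ ⊕ eq₂ ⊕ cross ⊕ -ℚ 1ℚ · e₂)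
      (solve (A ∷ B ∷ c₁ ∷ c₂ ∷ v ∷ x ∷ y ∷ r₂ ∷ S₁ ∷ S₂ ∷ []) ℚ-ring)

-- The claim covers every sufficient fuel, since a recursive call loses one unit of fuel while its
-- arguments may drop by more.
Ef-closed-form : ∀ fuel a b → suc a +ℕ suc b ≤ℕ fuel → ClosedForm a b (Ef fuel (suc a) (suc b))
Ef-closed-form (suc fuel) a b (s≤s a+b≤fuel) = ClosedForm-from-sums a b (sum₁ (suc a) f₁) (sum₁ (suc b) f₂)
  (sum₁-reverse (q (bin (suc a) (suc b))) (suc a) f₁ (term b) (λ j k j+k≡a →
    summand-value b j k (λ i → Ef fuel i (suc b)) j+k≡a refl (Ef-zeroˡ fuel (suc b))
      (λ { i (s≤s i<a) → Ef-closed-form fuel i b (ℕₚ.≤-trans (ℕₚ.+-monoˡ-≤ (suc b) i<a) a+b≤fuel) })))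
  (sum₁-reverse (q (bin (suc b) (suc a))) (suc b) f₂ (term a) (λ j k j+k≡b →
    summand-value a j k (λ i → Ef fuel (suc a) i) j+k≡b (ℕₚ.+-comm (suc b) (suc a)) (Ef-zeroʳ fuel (suc a))
      (λ { i (s≤s i<b) → ClosedForm-sym a i (Ef fuel (suc a) (suc i)) (Ef-closed-form fuel a i (ℕₚ.≤-trans (a+i< i<b) a+b≤fuel)) })))
  where
  f₁ f₂ : ℕ → ℚ
  f₁ k = frac (suc a C k) ((suc a +ℕ suc b) C k) * frac (suc b) (suc a +ℕ suc b ∸ k) * Ef fuel (suc a ∸ k) (suc b)
  f₂ k = frac (suc b C k) ((suc a +ℕ suc b) C k) * frac (suc a) (suc a +ℕ suc b ∸ k) * Ef fuel (suc a) (suc b ∸ k)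
  a+i< : ∀ {i} → suc i ≤ℕ b → suc a +ℕ suc i ≤ℕ a +ℕ suc b
  a+i< {i} i<b = subst (_≤ℕ a +ℕ suc b) (ℕₚ.+-suc a (suc i)) (ℕₚ.+-monoʳ-≤ a (s≤s i<b))

E-closed-form : ∀ a b → ClosedForm a b (E (suc a) (suc b))
E-closed-form a b = Ef-closed-form (suc a +ℕ suc b) a b ℕₚ.≤-refl

-- First-order recurrence on the diagonal

bin-central : ∀ n → q (suc n) * q (bin (suc n) (suc n)) ≡ κ 2 * (q (suc (n +ℕ n)) * q (bin n n))
bin-central n = begin
  q (suc n) * q (bin (suc n) (suc n))                ≡⟨ q-* (suc n) (bin (suc n) (suc n)) ⟨
  q (suc n *ℕ (bin n (suc n) +ℕ bin (suc n) n))      ≡⟨ cong q double ⟩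
  q (2 *ℕ (suc (n +ℕ n) *ℕ bin n n))                 ≡⟨ trans (q-* 2 (suc (n +ℕ n) *ℕ bin n n)) (cong (_* q (suc (n +ℕ n) *ℕ bin n n)) (q≡κ 2)) ⟩
  κ 2 * q (suc (n +ℕ n) *ℕ bin n n)                  ≡⟨ cong (κ 2 *_) (q-* (suc (n +ℕ n)) (bin n n)) ⟩
  κ 2 * (q (suc (n +ℕ n)) * q (bin n n))             ∎
  where
  open ≡-Reasoning
  regroup : ∀ m p → m *ℕ (p +ℕ p) ≡ 2 *ℕ (p *ℕ m)
  regroup = solveℕ-∀
  double : suc n *ℕ (bin n (suc n) +ℕ bin (suc n) n) ≡ 2 *ℕ (suc (n +ℕ n) *ℕ bin n n)
  double = trans (cong (λ p → suc n *ℕ (bin n (suc n) +ℕ p)) (bin-comm (suc n) n))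
    (trans (regroup (suc n) (bin n (suc n))) (cong (2 *ℕ_) (bin-absorb n n)))

-- The product (2x+1)c is kept together so that `DiagonalStep-scale` can replace it by a common
-- multiple.
DiagonalStep : ℚ → ℚ → ℚ → ℚ → Set
DiagonalStep x c e e′ = x * (κ 2 * x + 1ℚ) * ((κ 2 * x + 1ℚ) * c * (e′ + ½))
  ≡ κ 2 * (x + 1ℚ) * (x + 1ℚ) * ((κ 2 * x + 1ℚ) * c * e) - ½ * (x + 1ℚ) * (κ 3 * x + κ 2)

-- V(n+1,n+1) is the sum of V(n,n+1) and V(n+1,n) up to reciprocals, and on the diagonal `V-cross`
-- gives this sum from V(n,n).
E-diagonal-step : ∀ n .{{_ : NonZero n}} → DiagonalStep (q n) (q (bin n n)) (E n n) (E (suc n) (suc n))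
E-diagonal-step (suc a) = go {q a} {q (bin n n)} {q (bin (suc n) (suc n))} {E n n} {E (suc n) (suc n)} {V a a} {V a n} {V n a} {r (2 +ℕ (a +ℕ a))} {r (3 +ℕ (a +ℕ a))}
  (q-κ+ 1 a) (q-κ+ 2 a) (q-linear 2 a a) (q-linear 3 a a) (q-linear 4 a a)
  (q-linear 1 (suc a) (suc a)) (q-linear 2 (suc a) (suc a))
  (bin-central (suc a)) (E-closed-form a a) (E-closed-form (suc a) (suc a)) (V-cross a a)
  (r-inverse (2 +ℕ (a +ℕ a))) (r-inverse (3 +ℕ (a +ℕ a)))
  where
  n = suc a
  go : ∀ {A c c′ e e′ v x y r₂ r₃ a1 a2 s2 s3 s4 t1 t2} →
    a1 ≡ κ 1 + A → a2 ≡ κ 2 + A → s2 ≡ κ 2 + (A + A) → s3 ≡ κ 3 + (A + A) → s4 ≡ κ 4 + (A + A) →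
    t1 ≡ κ 1 + (a1 + a1) → t2 ≡ κ 2 + (a1 + a1) →
    a2 * c′ ≡ κ 2 * (t1 * c) →
    c * (e + ½) ≡ s2 * v →
    c′ * (e′ + ½) ≡ t2 * (x + y + (r₃ - r₂)) →
    a1 * x + a1 * y + (c + r₂) ≡ κ 2 * (s2 * v) →
    r₂ * s3 ≡ 1ℚ → r₃ * s4 ≡ 1ℚ →
    DiagonalStep a1 c e e′
  go {A} {c} {c′} {e} {e′} {v} {x} {y} {r₂} {r₃} refl refl refl refl refl refl refl central formula formula′ cross e₂ e₃ =
    let n = κ 1 + A
        k = κ 2 + A
        m = κ 3 + κ 2 * A
    -- The multipliers eliminate in turn `c′`, `x + y`, `v`, `r₂` and `r₃`.
    in cancel-combination
      ((-ℚ ½ * n * m * (e′ + ½)) · central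
        ⊕ (½ * n * m * k) · formula′
        ⊕ (m * k * k) · cross
        ⊕ (-ℚ κ 2 * m * k * k) · formula
        ⊕ (-ℚ (k * k * k)) · e₂
        ⊕ (½ * n * k * m) · e₃)
      (solve (A ∷ c ∷ c′ ∷ e ∷ e′ ∷ v ∷ x ∷ y ∷ r₂ ∷ r₃ ∷ []) ℚ-ring)

DiagonalStep-scale : ∀ x y {c e e′ d} → DiagonalStep x c e e′ → y * ((κ 2 * x + 1ℚ) * c) ≡ d →
  x * (κ 2 * x + 1ℚ) * (d * (e′ + ½))
    ≡ κ 2 * (x + 1ℚ) * (x + 1ℚ) * (d * e) - ½ * y * (x + 1ℚ) * (κ 3 * x + κ 2)
DiagonalStep-scale x y {c} {e} {e′} step refl =
  cancel-combination (y · step) (solve (x ∷ y ∷ c ∷ e ∷ e′ ∷ []) ℚ-ring)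

-- Elimination of the inhomogeneous terms

-- The coefficients of e₀, e₃ and e₁ determine the multipliers of the three steps; that the
-- coefficient of e₂ then agrees and the inhomogeneous terms cancel is a polynomial identity.
eliminate : ∀ x {x₁ x₂ d e₀ e₁ e₂ e₃} → x₁ ≡ κ 1 + x → x₂ ≡ κ 2 + x →
  x * (κ 2 * x + 1ℚ) * (d * (e₁ + ½))
    ≡ κ 2 * (x + 1ℚ) * (x + 1ℚ) * (d * e₀) - ½ * (κ 4 * (κ 2 * x + κ 3)) * (x + 1ℚ) * (κ 3 * x + κ 2) →
  x₁ * (κ 2 * x₁ + 1ℚ) * (d * (e₂ + ½))
    ≡ κ 2 * (x₁ + 1ℚ) * (x₁ + 1ℚ) * (d * e₁) - ½ * (κ 2 * x₁) * (x₁ + 1ℚ) * (κ 3 * x₁ + κ 2) →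
  x₂ * (κ 2 * x₂ + 1ℚ) * ((κ 2 * x₂ + 1ℚ) * d * (e₃ + ½))
    ≡ κ 2 * (x₂ + 1ℚ) * (x₂ + 1ℚ) * ((κ 2 * x₂ + 1ℚ) * d * e₂) - ½ * (x₁ * x₂) * (x₂ + 1ℚ) * (κ 3 * x₂ + κ 2) →
  d * (-ℚ κ 2 * (κ 18 * x ^ 4 + κ 159 * x ^ 3 + κ 528 * x ^ 2 + κ 779 * x + κ 428) * (x + κ 1) ^ 2 * (x + κ 2) * e₀
    + (x + κ 2) * (κ 216 * x ^ 6 + κ 2358 * x ^ 5 + κ 10485 * x ^ 4 + κ 24174 * x ^ 3 + κ 30251 * x ^ 2 + κ 19276 * x + κ 4800) * e₁
    + -ℚ (κ 324 * x ^ 7 + κ 4032 * x ^ 6 + κ 21015 * x ^ 5 + κ 59334 * x ^ 4 + κ 97813 * x ^ 3 + κ 93898 * x ^ 2 + κ 48288 * x + κ 10080) * e₂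
    + κ 2 * (x + κ 2) * (κ 18 * x ^ 4 + κ 87 * x ^ 3 + κ 159 * x ^ 2 + κ 128 * x + κ 36) * (κ 2 * x + κ 5) ^ 2 * e₃) ≡ 0ℚ
eliminate x {_} {_} {d} {e₀} {e₁} {e₂} {e₃} refl refl step₀ step₁ step₂ =
  let p₀ = κ 18 * x ^ 4 + κ 159 * x ^ 3 + κ 528 * x ^ 2 + κ 779 * x + κ 428
      -- 2(x+2) p₁ = P₁ - x(2x+1) p₀, where (x+2) P₁ is the coefficient of e₁
      p₁ = κ 90 * x ^ 5 + κ 831 * x ^ 4 + κ 2973 * x ^ 3 + κ 5098 * x ^ 2 + κ 4112 * x + κ 1200
      p₃ = κ 18 * x ^ 4 + κ 87 * x ^ 3 + κ 159 * x ^ 2 + κ 128 * x + κ 36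
  in cancel-combination ((p₀ * (x + κ 2)) · step₀ ⊕ -ℚ p₁ · step₁ ⊕ (κ 2 * p₃) · step₂)
       (solve (x ∷ d ∷ e₀ ∷ e₁ ∷ e₂ ∷ e₃ ∷ []) ℚ-ring)

-- Integer polynomials mapped into ℚ

-- The power of the ring solver has its own clause for exponent 1 and multiplies by the base on the
-- right, hence the three cases.
ι-^ : ∀ z k → ι (z ^ℤ k) ≡ ι z ^ k
ι-^ z zero          = refl
ι-^ z (suc zero)    = trans (ι-* z (+ 1)) (ℚₚ.*-identityʳ (ι z))
ι-^ z (suc (suc k)) = trans (ι-* z (z ^ℤ suc k))
  (trans (cong (ι z *_) (ι-^ z (suc k))) (ℚₚ.*-comm (ι z) (ι z ^ suc k)))

ι-neg : ∀ i → ι (- i) ≡ -ℚ ι i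
ι-neg i = ∙-cancelʳ (ι i) (ι (- i)) (-ℚ ι i)
  (trans (sym (ι-+ (- i) i)) (trans (cong ι (ℤₚ.+-inverseˡ i)) (sym (ℚₚ.+-inverseˡ (ι i)))))

-- A record, because unification can read i and x off Image i x but not off ι i ≡ x.
record Image (i : ℤ) (x : ℚ) : Set where
  constructor image
  field image-≡ : ι i ≡ x

open Image

infixl 6 _⊞_
infixl 7 _⊠_
infixr 8 _↑_

_⊞_ : ∀ {i j x y} → Image i x → Image j y → Image (i +ℤ j) (x + y)
_⊞_ {i} {j} (image eq) (image eq′) = image (trans (ι-+ i j) (cong₂ _+_ eq eq′))

_⊠_ : ∀ {i j x y} → Image i x → Image j y → Image (i *ℤ j) (x * y)
_⊠_ {i} {j} (image eq) (image eq′) = image (trans (ι-* i j) (cong₂ _*_ eq eq′))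

_↑_ : ∀ {i x} → Image i x → ∀ k → Image (i ^ℤ k) (x ^ k)
_↑_ {i} (image eq) k = image (trans (ι-^ i k) (cong (_^ k) eq))

neg : ∀ {i x} → Image i x → Image (- i) (-ℚ x)
neg {i} (image eq) = image (trans (ι-neg i) (cong -ℚ_ eq))

# : ∀ k → Image (+ k) (κ k)
# k = image refl

-- The third-order recurrence

-- The common multiple d = (n+1)(n+2) C(2n+4,n+2) gives the three diagonal steps one shared binomial
-- factor.
central-products : ∀ n → let x = q n; x₁ = q (suc n); d = x₁ * q (suc (suc n)) * q (bin (suc (suc n)) (suc (suc n))) in
  (κ 4 * (κ 2 * x + κ 3) * ((κ 2 * x + 1ℚ) * q (bin n n)) ≡ d)
  × (κ 2 * x₁ * ((κ 2 * x₁ + 1ℚ) * q (bin (suc n) (suc n))) ≡ d)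
central-products n = go {q n} {_} {q (suc (suc n))} {q (bin n n)} {q (bin (suc n) (suc n))} {q (bin (suc (suc n)) (suc (suc n)))}
  (q-κ+ 1 n) (q-linear 1 n n) (q-linear 1 (suc n) (suc n)) (bin-central n) (bin-central (suc n))
  where
  go : ∀ {x x₁ x₂ c₀ c₁ c₂ t t₁} → x₁ ≡ κ 1 + x → t ≡ κ 1 + (x + x) → t₁ ≡ κ 1 + (x₁ + x₁) →
    x₁ * c₁ ≡ κ 2 * (t * c₀) → x₂ * c₂ ≡ κ 2 * (t₁ * c₁) →
    (κ 4 * (κ 2 * x + κ 3) * ((κ 2 * x + 1ℚ) * c₀) ≡ x₁ * x₂ * c₂)
    × (κ 2 * x₁ * ((κ 2 * x₁ + 1ℚ) * c₁) ≡ x₁ * x₂ * c₂)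
  go {x} {_} {x₂} {c₀} {c₁} {c₂} refl refl refl central₀ central₁ =
    cancel-combination (-ℚ (κ 1 + x) · central₁ ⊕ (-ℚ κ 2 * (κ 3 + κ 2 * x)) · central₀)
      (solve (x ∷ x₂ ∷ c₀ ∷ c₁ ∷ c₂ ∷ []) ℚ-ring)
    , cancel-combination (-ℚ (κ 1 + x) · central₁) (solve (x ∷ x₂ ∷ c₀ ∷ c₁ ∷ c₂ ∷ []) ℚ-ring)

q-zero-product : ∀ d .{{_ : NonZero d}} {x a} → q d ≡ x → x * a ≡ 0ℚ → a ≡ 0ℚ
q-zero-product d refl eq = q-cancelˡ d (trans eq (sym (ℚₚ.*-zeroʳ (q d))))

recurrence : ∀ n .{{_ : NonZero n}} → let x = q n in
  -ℚ κ 2 * (κ 18 * x ^ 4 + κ 159 * x ^ 3 + κ 528 * x ^ 2 + κ 779 * x + κ 428) * (x + κ 1) ^ 2 * (x + κ 2) * E n n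
    + (x + κ 2) * (κ 216 * x ^ 6 + κ 2358 * x ^ 5 + κ 10485 * x ^ 4 + κ 24174 * x ^ 3 + κ 30251 * x ^ 2 + κ 19276 * x + κ 4800) * E (1 +ℕ n) (1 +ℕ n)
    + -ℚ (κ 324 * x ^ 7 + κ 4032 * x ^ 6 + κ 21015 * x ^ 5 + κ 59334 * x ^ 4 + κ 97813 * x ^ 3 + κ 93898 * x ^ 2 + κ 48288 * x + κ 10080) * E (2 +ℕ n) (2 +ℕ n)
    + κ 2 * (x + κ 2) * (κ 18 * x ^ 4 + κ 87 * x ^ 3 + κ 159 * x ^ 2 + κ 128 * x + κ 36) * (κ 2 * x + κ 5) ^ 2 * E (3 +ℕ n) (3 +ℕ n) ≡ 0ℚ
recurrence n = q-zero-product D {{D≢0}} D-product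
  (eliminate (q n) {q (suc n)} {q (suc (suc n))} {q (suc n) * q (suc (suc n)) * q C₂} {e 0} {e 1} {e 2} {e 3}
    (q-κ+ 1 n) (q-κ+ 2 n) step₀ step₁ step₂)
  where
  e : ℕ → ℚ
  e k = E (k +ℕ n) (k +ℕ n)
  C₂ = bin (suc (suc n)) (suc (suc n))
  -- `D` is the natural number behind d; being nonzero, it can be cancelled.
  D = suc n *ℕ suc (suc n) *ℕ C₂
  D≢0 : NonZero D
  D≢0 = ℕₚ.m*n≢0 (suc n *ℕ suc (suc n)) C₂ {{_}} {{bin≢0 (suc (suc n)) (suc (suc n))}}
  D-product : q D ≡ q (suc n) * q (suc (suc n)) * q C₂
  D-product = trans (q-* (suc n *ℕ suc (suc n)) C₂) (cong (_* q C₂) (q-* (suc n) (suc (suc n))))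
  step₀ = DiagonalStep-scale (q n) (κ 4 * (κ 2 * q n + κ 3)) {q (bin n n)} {e 0} {e 1} (E-diagonal-step n) (proj₁ (central-products n))
  step₁ = DiagonalStep-scale (q (suc n)) (κ 2 * q (suc n)) {q (bin (suc n) (suc n))} {e 1} {e 2} (E-diagonal-step (suc n)) (proj₂ (central-products n))
  step₂ = DiagonalStep-scale (q (suc (suc n))) (q (suc n) * q (suc (suc n))) {q C₂} {e 2} {e 3} (E-diagonal-step (suc (suc n)))
            (regroup (q (suc n)) (q (suc (suc n))) (κ 2 * q (suc (suc n)) + 1ℚ) (q C₂))
    where
    regroup : ∀ x₁ x₂ t c → x₁ * x₂ * (t * c) ≡ t * (x₁ * x₂ * c)
    regroup x₁ x₂ t c = solve (x₁ ∷ x₂ ∷ t ∷ c ∷ []) ℚ-ring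

theorem2 : (E 1 1 ≡ 1ℚ) × (E 2 2 ≡ + 17 / 9) × (E 3 3 ≡ + 143 / 50)
    × ((n : ℕ) → n ≥ 1 →
    ι (- (+ 2) *ℤ (+ 18 *ℤ (+ n) ^ℤ 4 +ℤ + 159 *ℤ (+ n) ^ℤ 3 +ℤ + 528 *ℤ (+ n) ^ℤ 2 +ℤ + 779 *ℤ (+ n) +ℤ + 428) *ℤ ((+ n) +ℤ + 1) ^ℤ 2 *ℤ ((+ n) +ℤ + 2)) * E n n
    + ι (((+ n) +ℤ + 2) *ℤ (+ 216 *ℤ (+ n) ^ℤ 6 +ℤ + 2358 *ℤ (+ n) ^ℤ 5 +ℤ + 10485 *ℤ (+ n) ^ℤ 4 +ℤ + 24174 *ℤ (+ n) ^ℤ 3 +ℤ + 30251 *ℤ (+ n) ^ℤ 2 +ℤ + 19276 *ℤ (+ n) +ℤ + 4800)) * E (n +ℕ 1) (n +ℕ 1)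
    + ι (- (+ 324 *ℤ (+ n) ^ℤ 7 +ℤ + 4032 *ℤ (+ n) ^ℤ 6 +ℤ + 21015 *ℤ (+ n) ^ℤ 5 +ℤ + 59334 *ℤ (+ n) ^ℤ 4 +ℤ + 97813 *ℤ (+ n) ^ℤ 3 +ℤ + 93898 *ℤ (+ n) ^ℤ 2 +ℤ + 48288 *ℤ (+ n) +ℤ + 10080)) * E (n +ℕ 2) (n +ℕ 2)
    + ι (+ 2 *ℤ ((+ n) +ℤ + 2) *ℤ (+ 18 *ℤ (+ n) ^ℤ 4 +ℤ + 87 *ℤ (+ n) ^ℤ 3 +ℤ + 159 *ℤ (+ n) ^ℤ 2 +ℤ + 128 *ℤ (+ n) +ℤ + 36) *ℤ (+ 2 *ℤ (+ n) +ℤ + 5) ^ℤ 2) * E (n +ℕ 3) (n +ℕ 3)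
    ≡ 0ℚ)
theorem2 = refl , refl , refl , λ { n@(suc _) _ →
  -- Respelling each coefficient with the `Image` operations turns `ι` of a polynomial in n into the
  -- same polynomial in `q n`.
  let x = image {i = + n} (sym (q≡κ n)) in
  trans (cong₂ _+_ (cong₂ _+_ (cong₂ _+_
    (cong₂ _*_ (image-≡ (neg (# 2) ⊠ (# 18 ⊠ x ↑ 4 ⊞ # 159 ⊠ x ↑ 3 ⊞ # 528 ⊠ x ↑ 2 ⊞ # 779 ⊠ x ⊞ # 428) ⊠ (x ⊞ # 1) ↑ 2 ⊠ (x ⊞ # 2)))
      refl)
    (cong₂ _*_ (image-≡ ((x ⊞ # 2) ⊠ (# 216 ⊠ x ↑ 6 ⊞ # 2358 ⊠ x ↑ 5 ⊞ # 10485 ⊠ x ↑ 4 ⊞ # 24174 ⊠ x ↑ 3 ⊞ # 30251 ⊠ x ↑ 2 ⊞ # 19276 ⊠ x ⊞ # 4800)))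
      (cong (λ m → E m m) (ℕₚ.+-comm n 1))))
    (cong₂ _*_ (image-≡ (neg (# 324 ⊠ x ↑ 7 ⊞ # 4032 ⊠ x ↑ 6 ⊞ # 21015 ⊠ x ↑ 5 ⊞ # 59334 ⊠ x ↑ 4 ⊞ # 97813 ⊠ x ↑ 3 ⊞ # 93898 ⊠ x ↑ 2 ⊞ # 48288 ⊠ x ⊞ # 10080)))
      (cong (λ m → E m m) (ℕₚ.+-comm n 2))))
    (cong₂ _*_ (image-≡ (# 2 ⊠ (x ⊞ # 2) ⊠ (# 18 ⊠ x ↑ 4 ⊞ # 87 ⊠ x ↑ 3 ⊞ # 159 ⊠ x ↑ 2 ⊞ # 128 ⊠ x ⊞ # 36) ⊠ (# 2 ⊠ x ⊞ # 5) ↑ 2))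
      (cong (λ m → E m m) (ℕₚ.+-comm n 3))))
    (recurrence n) }
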